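{- Let $H$ be a complex Hadamard matrix. Let $\{R,R_1,R_2\}$ be a partition of the set of rows of $H$ and $\{C,C_1,C_2\}$ a partition of the set of columns of $H$, and suppose there is $s\in\mathbb{C}$ such that: (1) every column of the submatrix with rows $R$ and columns $C$ has entry sum $s$; (2) every column of the submatrix with rows $R_1$ and columns $C_1$ has entry sum $-\overline{s}$; (3) the submatrix with rows $R$ and columns $C_1$ and the submatrix with rows $R_1$ and columns $C$ are all-ones matrices; (4) every column of the submatrix with rows $R$ and columns $C_2$, and every column of the submatrix with rows $R_1$ and columns $C_2$, has entry sum $0$. Then for every $z\in\mathbb{T}$, the matrix $K$ obtained from $H$ by multiplying every entry of the submatrix with rows $R_1$ and columns $C_2$ by $z$, and simultaneously every entry of the submatrix with rows $R_2$ and columns $C_1$ by $\overline{z}$ (all other entries unchanged), is a complex Hadamard matrix.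
   Context: $\mathbb{T}$ is the set of complex numbers of modulus $1$. A complex Hadamard matrix of order $n$ is an $n\times n$ matrix with all entries in $\mathbb{T}$ and $HH^{\ast}=nI_n$. -}

module Defs where

open import Algebra.Bundles using (CommutativeMonoid)
open import Algebra.Bundles.Raw using (RawMonoid)
open import Data.Bool.Base using (if_then_else_; _∧_)
open import Data.Fin.Base using (Fin)
open import Data.Fin.Properties using (_≟_)
open import Data.Fin.Subset using (Subset; _∈_; _∉_)
open import Data.Fin.Subset.Properties using (_∈?_)
open import Data.Nat.Base as ℕ using (ℕ; _⊔_)
import Data.Nat.Properties as ℕₚ
open import Data.Product.Base using (∃-syntax; _×_; _,_)
open import Data.Rational.Base as ℚ using (ℚ; 0ℚ; 1ℚ; ½; ∣_∣)
import Data.Rational.Properties as ℚₚ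
open import Data.Sum.Base using (_⊎_)
open import Level using (0ℓ)
open import Relation.Binary.PropositionalEquality
  using (_≡_; refl; sym; trans; cong; cong₂; subst; subst₂)
open import Relation.Nullary.Decidable.Core using (does)

-- Real numbers: Cauchy sequences of rationals, with the equivalence _≃ᴿ_
-- (difference tends to 0) in the role of equality.

IsCauchy : (ℕ → ℚ) → Set
IsCauchy x = ∀ ε → 0ℚ ℚ.< ε →
  ∃[ N ] (∀ m n → N ℕ.≤ m → N ℕ.≤ n → ∣ x m ℚ.- x n ∣ ℚ.< ε)

record ℝ : Set where
  constructor mkℝ
  field
    seq    : ℕ → ℚ
    cauchy : IsCauchy seq

open ℝ public

infix 4 _≃ᴿ_ _≤ᴿ_

record _≃ᴿ_ (x y : ℝ) : Set where
  constructor mk≃ᴿ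
  field
    close : ∀ ε → 0ℚ ℚ.< ε →
      ∃[ N ] (∀ n → N ℕ.≤ n → ∣ seq x n ℚ.- seq y n ∣ ℚ.< ε)

record _≤ᴿ_ (x y : ℝ) : Set where
  constructor mk≤ᴿ
  field
    below : ∀ ε → 0ℚ ℚ.< ε →
      ∃[ N ] (∀ n → N ℕ.≤ n → seq x n ℚ.< seq y n ℚ.+ ε)

module CauchyLemmas where
  open import Algebra.Properties.AbelianGroup ℚₚ.+-0-abelianGroup using (xyx⁻¹≈y)
  open import Algebra.Properties.CommutativeSemigroup
    (CommutativeMonoid.commutativeSemigroup ℚₚ.+-0-commutativeMonoid) using (interchange)

  abstract
    half-pos : ∀ ε → 0ℚ ℚ.< ε → 0ℚ ℚ.< ½ ℚ.* ε
    half-pos ε 0<ε =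
      subst (ℚ._< ½ ℚ.* ε) (ℚₚ.*-zeroʳ ½) (ℚₚ.*-monoʳ-<-pos ½ 0<ε)

    halves : ∀ ε → ½ ℚ.* ε ℚ.+ ½ ℚ.* ε ≡ ε
    halves ε = trans (sym (ℚₚ.*-distribʳ-+ ε ½ ½)) (ℚₚ.*-identityˡ ε)

    const-cauchy : ∀ q → IsCauchy (λ _ → q)
    const-cauchy q ε 0<ε = 0 , λ _ _ _ _ →
      subst (ℚ._< ε) (sym (cong ∣_∣ (ℚₚ.+-inverseʳ q))) 0<ε

    +-rearrange : ∀ a b c d →
      (a ℚ.+ b) ℚ.- (c ℚ.+ d) ≡ (a ℚ.- c) ℚ.+ (b ℚ.- d)
    +-rearrange a b c d = trans
      (cong (a ℚ.+ b ℚ.+_) (ℚₚ.neg-distrib-+ c d)) (interchange a b (ℚ.- c) (ℚ.- d))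

    +-cauchy : ∀ {x y} → IsCauchy x → IsCauchy y → IsCauchy (λ n → x n ℚ.+ y n)
    +-cauchy {x} {y} cx cy ε 0<ε
      with cx (½ ℚ.* ε) (half-pos ε 0<ε) | cy (½ ℚ.* ε) (half-pos ε 0<ε)
    ... | M , p | N , q = M ⊔ N , λ m n M⊔N≤m M⊔N≤n →
      subst₂ ℚ._<_ (cong ∣_∣ (sym (+-rearrange (x m) (y m) (x n) (y n)))) (halves ε)
        (ℚₚ.≤-<-trans (ℚₚ.∣p+q∣≤∣p∣+∣q∣ (x m ℚ.- x n) (y m ℚ.- y n))
          (ℚₚ.+-mono-< (p m n (ℕₚ.m⊔n≤o⇒m≤o M N M⊔N≤m) (ℕₚ.m⊔n≤o⇒m≤o M N M⊔N≤n))
                       (q m n (ℕₚ.m⊔n≤o⇒n≤o M N M⊔N≤m) (ℕₚ.m⊔n≤o⇒n≤o M N M⊔N≤n))))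

    -‿rearrange : ∀ a b → (ℚ.- a) ℚ.- (ℚ.- b) ≡ ℚ.- (a ℚ.- b)
    -‿rearrange a b = sym (ℚₚ.neg-distrib-+ a (ℚ.- b))

    -‿cauchy : ∀ {x} → IsCauchy x → IsCauchy (λ n → ℚ.- x n)
    -‿cauchy {x} cx ε 0<ε with cx ε 0<ε
    ... | N , p = N , λ m n N≤m N≤n →
      subst (ℚ._< ε)
        (sym (trans (cong ∣_∣ (-‿rearrange (x m) (x n))) (ℚₚ.∣-p∣≡∣p∣ (x m ℚ.- x n))))
        (p m n N≤m N≤n)

    0<1 : 0ℚ ℚ.< 1ℚ
    0<1 = ℚₚ.positive⁻¹ 1ℚ

    split : ∀ a b → a ≡ b ℚ.+ (a ℚ.- b)
    split a b = trans (sym (xyx⁻¹≈y b a)) (ℚₚ.+-assoc b a (ℚ.- b))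

    eventually-bounded : ∀ {x} → IsCauchy x →
      ∃[ B ] (0ℚ ℚ.< B × ∃[ N ] (∀ n → N ℕ.≤ n → ∣ x n ∣ ℚ.≤ B))
    eventually-bounded {x} cx with cx 1ℚ 0<1
    ... | N , p = ∣ x N ∣ ℚ.+ 1ℚ , ℚₚ.+-mono-≤-< (ℚₚ.0≤∣p∣ (x N)) 0<1 , N , λ n N≤n →
      subst (λ t → ∣ t ∣ ℚ.≤ ∣ x N ∣ ℚ.+ 1ℚ) (sym (split (x n) (x N)))
        (ℚₚ.≤-trans (ℚₚ.∣p+q∣≤∣p∣+∣q∣ (x N) (x n ℚ.- x N))
          (ℚₚ.+-monoʳ-≤ ∣ x N ∣ (ℚₚ.<⇒≤ (p n N N≤n ℕₚ.≤-refl))))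

    *-rearrange : ∀ a b c d →
      a ℚ.* b ℚ.- c ℚ.* d ≡ a ℚ.* (b ℚ.- d) ℚ.+ d ℚ.* (a ℚ.- c)
    *-rearrange a b c d = sym (trans (cong₂ ℚ._+_ (distrib a b d)
        (trans (distrib d a c) (cong₂ ℚ._-_ (ℚₚ.*-comm d a) (ℚₚ.*-comm d c))))
      (telescope (a ℚ.* b) (a ℚ.* d) (c ℚ.* d)))
      where
      distrib : ∀ p q r → p ℚ.* (q ℚ.- r) ≡ p ℚ.* q ℚ.- p ℚ.* r
      distrib p q r = trans (ℚₚ.*-distribˡ-+ p q (ℚ.- r))
        (cong (p ℚ.* q ℚ.+_) (sym (ℚₚ.neg-distribʳ-* p r)))
      telescope : ∀ p q r → (p ℚ.- q) ℚ.+ (q ℚ.- r) ≡ p ℚ.- r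
      telescope p q r = trans (ℚₚ.+-assoc p (ℚ.- q) (q ℚ.- r)) (cong (p ℚ.+_)
        (trans (sym (ℚₚ.+-assoc (ℚ.- q) q (ℚ.- r)))
          (trans (cong (ℚ._- r) (ℚₚ.+-inverseˡ q)) (ℚₚ.+-identityˡ (ℚ.- r)))))

    scale-down : ∀ B ε → 0ℚ ℚ.< B → 0ℚ ℚ.< ε → ∃[ δ ] (0ℚ ℚ.< δ × B ℚ.* δ ≡ ε)
    scale-down B ε 0<B 0<ε = ℚ.1/ B ℚ.* ε , δ-pos , eq
      where
      instance
        B-pos : ℚ.Positive B
        B-pos = ℚ.positive 0<B
        B-nonZero : ℚ.NonZero B
        B-nonZero = ℚₚ.pos⇒nonZero B
        1/B-pos : ℚ.Positive (ℚ.1/ B)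
        1/B-pos = ℚₚ.1/pos⇒pos B
      δ-pos : 0ℚ ℚ.< ℚ.1/ B ℚ.* ε
      δ-pos = subst (ℚ._< ℚ.1/ B ℚ.* ε) (ℚₚ.*-zeroʳ (ℚ.1/ B)) (ℚₚ.*-monoʳ-<-pos (ℚ.1/ B) 0<ε)
      eq : B ℚ.* (ℚ.1/ B ℚ.* ε) ≡ ε
      eq = trans (sym (ℚₚ.*-assoc B (ℚ.1/ B) ε))
          (trans (cong (ℚ._* ε) (ℚₚ.*-inverseʳ B)) (ℚₚ.*-identityˡ ε))

    ∣*∣-bound : ∀ a b B δ → 0ℚ ℚ.< B → ∣ a ∣ ℚ.≤ B → ∣ b ∣ ℚ.< δ → ∣ a ℚ.* b ∣ ℚ.< B ℚ.* δ
    ∣*∣-bound a b B δ 0<B a≤B b<δ =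
      subst (ℚ._< B ℚ.* δ) (sym (ℚₚ.∣p*q∣≡∣p∣*∣q∣ a b))
        (ℚₚ.≤-<-trans
          (ℚₚ.*-monoʳ-≤-nonNeg ∣ b ∣ {{ℚ.nonNegative (ℚₚ.0≤∣p∣ b)}} a≤B)
          (ℚₚ.*-monoʳ-<-pos B {{ℚ.positive 0<B}} b<δ))

    *-cauchy : ∀ {x y} → IsCauchy x → IsCauchy y → IsCauchy (λ n → x n ℚ.* y n)
    *-cauchy {x} {y} cx cy ε 0<ε
      with eventually-bounded cx | eventually-bounded cy
    ... | A , 0<A , K , ∣x∣≤A | B , 0<B , L , ∣y∣≤B
      with scale-down (A ℚ.+ B) ε (ℚₚ.+-mono-< 0<A 0<B) 0<ε
    ... | δ , 0<δ , [A+B]δ≡ε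
      with cx δ 0<δ | cy δ 0<δ
    ... | M , p | N , q = (K ⊔ L) ⊔ (M ⊔ N) , λ m n ≤m ≤n →
      let K⊔L≤m = ℕₚ.m⊔n≤o⇒m≤o (K ⊔ L) (M ⊔ N) ≤m
          K⊔L≤n = ℕₚ.m⊔n≤o⇒m≤o (K ⊔ L) (M ⊔ N) ≤n
          M⊔N≤m = ℕₚ.m⊔n≤o⇒n≤o (K ⊔ L) (M ⊔ N) ≤m
          M⊔N≤n = ℕₚ.m⊔n≤o⇒n≤o (K ⊔ L) (M ⊔ N) ≤n
      in subst₂ ℚ._<_
        (cong ∣_∣ (sym (*-rearrange (x m) (y m) (x n) (y n))))
        (trans (sym (ℚₚ.*-distribʳ-+ δ A B)) [A+B]δ≡ε)
        (ℚₚ.≤-<-trans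
          (ℚₚ.∣p+q∣≤∣p∣+∣q∣ (x m ℚ.* (y m ℚ.- y n)) (y n ℚ.* (x m ℚ.- x n)))
          (ℚₚ.+-mono-<
            (∣*∣-bound (x m) (y m ℚ.- y n) A δ 0<A
              (∣x∣≤A m (ℕₚ.m⊔n≤o⇒m≤o K L K⊔L≤m))
              (q m n (ℕₚ.m⊔n≤o⇒n≤o M N M⊔N≤m) (ℕₚ.m⊔n≤o⇒n≤o M N M⊔N≤n)))
            (∣*∣-bound (y n) (x m ℚ.- x n) B δ 0<B
              (∣y∣≤B n (ℕₚ.m⊔n≤o⇒n≤o K L K⊔L≤n))
              (p m n (ℕₚ.m⊔n≤o⇒m≤o M N M⊔N≤m) (ℕₚ.m⊔n≤o⇒m≤o M N M⊔N≤n)))))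

open CauchyLemmas

infixl 6 _+ᴿ_ _-ᴿ_
infixl 7 _*ᴿ_
infix  8 -ᴿ_

0ᴿ 1ᴿ : ℝ
0ᴿ = mkℝ (λ _ → 0ℚ) (const-cauchy 0ℚ)
1ᴿ = mkℝ (λ _ → 1ℚ) (const-cauchy 1ℚ)

_+ᴿ_ _*ᴿ_ : ℝ → ℝ → ℝ
mkℝ x cx +ᴿ mkℝ y cy = mkℝ (λ n → x n ℚ.+ y n) (+-cauchy {x} {y} cx cy)
mkℝ x cx *ᴿ mkℝ y cy = mkℝ (λ n → x n ℚ.* y n) (*-cauchy {x} {y} cx cy)

-ᴿ_ : ℝ → ℝ
-ᴿ mkℝ x cx = mkℝ (λ n → ℚ.- x n) (-‿cauchy {x} cx)

_-ᴿ_ : ℝ → ℝ → ℝ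
x -ᴿ y = x +ᴿ (-ᴿ y)

infix 5 _+i_

record ℂ : Set where
  constructor _+i_
  field
    re im : ℝ

open ℂ public

infix  4 _≃_
infixl 6 _+_
infixl 7 _*_
infix  8 -_

record _≃_ (w z : ℂ) : Set where
  constructor mk≃
  field
    re-≃ : re w ≃ᴿ re z
    im-≃ : im w ≃ᴿ im z

0ℂ 1ℂ : ℂ
0ℂ = 0ᴿ +i 0ᴿ
1ℂ = 1ᴿ +i 0ᴿ

_+_ _*_ : ℂ → ℂ → ℂ
w + z = (re w +ᴿ re z) +i (im w +ᴿ im z)
w * z = (re w *ᴿ re z -ᴿ im w *ᴿ im z) +i (re w *ᴿ im z +ᴿ im w *ᴿ re z)

-_ conj : ℂ → ℂ
- z    = (-ᴿ re z) +i (-ᴿ im z)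
conj z = re z +i (-ᴿ im z)

-- r is the nonnegative square root of re² + im²; stating it as a relation
-- avoids constructing square roots.
HasModulus : ℂ → ℝ → Set
HasModulus z r = 0ᴿ ≤ᴿ r × r *ᴿ r ≃ᴿ re z *ᴿ re z +ᴿ im z *ᴿ im z

_∈𝕋 : ℂ → Set
z ∈𝕋 = HasModulus z 1ᴿ

+-rawMonoid : RawMonoid 0ℓ 0ℓ
+-rawMonoid = record { Carrier = ℂ ; _≈_ = _≃_ ; _∙_ = _+_ ; ε = 0ℂ }

-- n ×ℂ z is the n-fold sum z + ⋯ + z.
open import Algebra.Definitions.RawMonoid +-rawMonoid public
  using (sum) renaming (_×_ to _×ℂ_)

Matrix : ℕ → Set
Matrix n = Fin n → Fin n → ℂ

_⊛_ : ∀ {n} → Matrix n → Matrix n → Matrix n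
(A ⊛ B) i j = sum (λ k → A i k * B k j)

_ᴴ : ∀ {n} → Matrix n → Matrix n
(A ᴴ) i j = conj (A j i)

I : ∀ {n} → Matrix n
I i j = if does (i ≟ j) then 1ℂ else 0ℂ

record IsComplexHadamard {n : ℕ} (H : Matrix n) : Set where
  field
    unimodular : ∀ i j → H i j ∈𝕋
    orthogonal : ∀ i j → (H ⊛ (H ᴴ)) i j ≃ n ×ℂ I i j

-- The parts are allowed to be empty.
record IsPartition {n : ℕ} (A B C : Subset n) : Set where
  field
    cover : ∀ i → i ∈ A ⊎ i ∈ B ⊎ i ∈ C
    A∩B≡∅ : ∀ i → i ∈ A → i ∉ B
    A∩C≡∅ : ∀ i → i ∈ A → i ∉ C
    B∩C≡∅ : ∀ i → i ∈ B → i ∉ C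

columnSum : ∀ {n} → Matrix n → Subset n → Fin n → ℂ
columnSum H R j = sum (λ i → if does (i ∈? R) then H i j else 0ℂ)

EveryColumnSum : ∀ {n} → Matrix n → Subset n → Subset n → ℂ → Set
EveryColumnSum H R C s = ∀ j → j ∈ C → columnSum H R j ≃ s

AllOnes : ∀ {n} → Matrix n → Subset n → Subset n → Set
AllOnes H R C = ∀ i j → i ∈ R → j ∈ C → H i j ≃ 1ℂ

switch : ∀ {n} → ℂ → (R₁ R₂ C₁ C₂ : Subset n) → Matrix n → Matrix n
switch z R₁ R₂ C₁ C₂ H i j =
  if does (i ∈? R₁) ∧ does (j ∈? C₂) then z * H i j
  else if does (i ∈? R₂) ∧ does (j ∈? C₁) then conj z * H i j
  else H i j

{-# OPTIONS --safe #-}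
module Submission where

-- The switch makes the columns, rather than the rows, visibly orthogonal: the
-- inner product of columns j and l of H is the sum of the contributions of
-- the row blocks R, R₁, R₂, and switching multiplies each contribution by a
-- factor depending only on the column blocks of j and l. The hypotheses on
-- the sums make the contributions that would be scaled unequally cancel or
-- vanish, e.g. s̄ − s̄ = 0 from R and R₁ when j ∈ C and l ∈ C₁. That
-- orthogonality of the rows and of the columns are equivalent follows from
-- positive definiteness alone, without determinants: if AᴴA = nI and the
-- entries of A are unimodular, then the Hermitian matrix M = AAᴴ − nI has zero
-- diagonal and satisfies MMᴴ = −nM, so every row of M has norm 0.

open import Algebra.Bundles using (CommutativeRing)
import Algebra.Consequences.Setoid as Consequences
import Algebra.Properties.CommutativeSemigroup as CommutativeSemigroupProperties
import Algebra.Properties.Group as GroupProperties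
import Algebra.Properties.Semiring.Mult as SemiringMult
import Algebra.Properties.Semiring.Sum as SemiringSum
open import Data.Bool.Base using (if_then_else_; _∧_; true; false)
open import Data.Bool.Properties using (∧-zeroʳ)
open import Data.Fin.Base using (Fin; zero; suc)
open import Data.Fin.Properties using (_≟_)
open import Data.Fin.Subset using (Subset; _∈_; _∉_)
open import Data.Fin.Subset.Properties using (_∈?_)
open import Data.Nat.Base as ℕ using (ℕ; zero; suc; _⊔_)
import Data.Nat.Properties as ℕₚ
open import Data.Product.Base using (_×_; _,_; proj₁; proj₂)
open import Data.Rational.Base as ℚ using (ℚ; 0ℚ; 1ℚ; ½; ∣_∣)
import Data.Rational.Properties as ℚₚ
open import Data.Rational.Solver using (module +-*-Solver)
open import Data.Sum.Base using (inj₁; inj₂)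
open import Function.Base using (_∘_)
open import Level using (0ℓ)
open import Relation.Binary.Bundles using (Setoid)
open import Relation.Binary.PropositionalEquality as ≡
  using (_≡_; _≢_; subst; subst₂)
open import Relation.Nullary.Decidable using (yes; no; does; dec-true; dec-false)
open import Defs

open +-*-Solver using (solve; con; _:=_; _:+_; _:*_; _:-_; :-_)
open CauchyLemmas

-- Real numbers

-- The operations act term by term on sequences, so each ring law below reduces to an identity of
-- rationals at every index.
pointwise⇒≃ᴿ : ∀ {x y} → (∀ n → seq x n ≡ seq y n) → x ≃ᴿ y
pointwise⇒≃ᴿ {x} {y} x≗y = mk≃ᴿ λ ε 0<ε → 0 , λ n _ →
  subst (ℚ._< ε) (≡.sym (≡.cong ∣_∣
    (≡.trans (≡.cong (ℚ._- seq y n) (x≗y n)) (ℚₚ.+-inverseʳ (seq y n))))) 0<ε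

≃ᴿ-refl : ∀ {x} → x ≃ᴿ x
≃ᴿ-refl = pointwise⇒≃ᴿ λ _ → ≡.refl

∣p-q∣≡∣q-p∣ : ∀ p q → ∣ p ℚ.- q ∣ ≡ ∣ q ℚ.- p ∣
∣p-q∣≡∣q-p∣ p q = ≡.trans (≡.sym (ℚₚ.∣-p∣≡∣p∣ (p ℚ.- q)))
  (≡.cong ∣_∣ (solve 2 (λ p q → :- (p :- q) := q :- p) ≡.refl p q))

≃ᴿ-sym : ∀ {x y} → x ≃ᴿ y → y ≃ᴿ x
≃ᴿ-sym {x} {y} (mk≃ᴿ x≃y) = mk≃ᴿ λ ε 0<ε → let N , p = x≃y ε 0<ε in
  N , λ n N≤n → subst (ℚ._< ε) (∣p-q∣≡∣q-p∣ (seq x n) (seq y n)) (p n N≤n)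

sum-close : ∀ {p q ε} → ∣ p ∣ ℚ.< ½ ℚ.* ε → ∣ q ∣ ℚ.< ½ ℚ.* ε → ∣ p ℚ.+ q ∣ ℚ.< ε
sum-close {p} {q} {ε} p< q< = subst (∣ p ℚ.+ q ∣ ℚ.<_) (halves ε)
  (ℚₚ.≤-<-trans (ℚₚ.∣p+q∣≤∣p∣+∣q∣ p q) (ℚₚ.+-mono-< p< q<))

≃ᴿ-trans : ∀ {x y z} → x ≃ᴿ y → y ≃ᴿ z → x ≃ᴿ z
≃ᴿ-trans {x} {y} {z} (mk≃ᴿ x≃y) (mk≃ᴿ y≃z) = mk≃ᴿ λ ε 0<ε →
  let M , p = x≃y (½ ℚ.* ε) (half-pos ε 0<ε)
      N , q = y≃z (½ ℚ.* ε) (half-pos ε 0<ε)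
  in M ⊔ N , λ n ≤n → subst (λ t → ∣ t ∣ ℚ.< ε)
       (solve 3 (λ x y z → (x :- y) :+ (y :- z) := x :- z) ≡.refl (seq x n) (seq y n) (seq z n))
       (sum-close (p n (ℕₚ.m⊔n≤o⇒m≤o M N ≤n)) (q n (ℕₚ.m⊔n≤o⇒n≤o M N ≤n)))

+ᴿ-cong : ∀ {x x′ y y′} → x ≃ᴿ x′ → y ≃ᴿ y′ → x +ᴿ y ≃ᴿ x′ +ᴿ y′
+ᴿ-cong {x} {x′} {y} {y′} (mk≃ᴿ x≃x′) (mk≃ᴿ y≃y′) = mk≃ᴿ λ ε 0<ε →
  let M , p = x≃x′ (½ ℚ.* ε) (half-pos ε 0<ε)
      N , q = y≃y′ (½ ℚ.* ε) (half-pos ε 0<ε)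
  in M ⊔ N , λ n ≤n → subst (λ t → ∣ t ∣ ℚ.< ε)
       (≡.sym (+-rearrange (seq x n) (seq y n) (seq x′ n) (seq y′ n)))
       (sum-close (p n (ℕₚ.m⊔n≤o⇒m≤o M N ≤n)) (q n (ℕₚ.m⊔n≤o⇒n≤o M N ≤n)))

-ᴿ-cong : ∀ {x y} → x ≃ᴿ y → -ᴿ x ≃ᴿ -ᴿ y
-ᴿ-cong {x} {y} (mk≃ᴿ x≃y) = mk≃ᴿ λ ε 0<ε → let N , p = x≃y ε 0<ε in
  N , λ n N≤n → subst (ℚ._< ε)
    (≡.sym (≡.trans (≡.cong ∣_∣ (-‿rearrange (seq x n) (seq y n)))
      (ℚₚ.∣-p∣≡∣p∣ (seq x n ℚ.- seq y n))))
    (p n N≤n)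

*ᴿ-comm : ∀ x y → x *ᴿ y ≃ᴿ y *ᴿ x
*ᴿ-comm x y = pointwise⇒≃ᴿ λ n → ℚₚ.*-comm (seq x n) (seq y n)

-- `x` is eventually bounded by some `B > 0`, so it is enough that `y` and `y′` come within `ε / B`
-- of each other.
*ᴿ-congˡ : ∀ {x y y′} → y ≃ᴿ y′ → x *ᴿ y ≃ᴿ x *ᴿ y′
*ᴿ-congˡ {x} {y} {y′} (mk≃ᴿ y≃y′) = mk≃ᴿ λ ε 0<ε →
  let B , 0<B , M , ∣x∣≤B = eventually-bounded (cauchy x)
      δ , 0<δ , Bδ≡ε = scale-down B ε 0<B 0<ε
      N , p = y≃y′ δ 0<δ
  in M ⊔ N , λ n ≤n → subst₂ ℚ._<_
       (≡.cong ∣_∣ (solve 3 (λ x y z → x :* (y :- z) := x :* y :- x :* z) ≡.refl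
         (seq x n) (seq y n) (seq y′ n)))
       Bδ≡ε
       (∣*∣-bound (seq x n) (seq y n ℚ.- seq y′ n) B δ 0<B
         (∣x∣≤B n (ℕₚ.m⊔n≤o⇒m≤o M N ≤n)) (p n (ℕₚ.m⊔n≤o⇒n≤o M N ≤n)))

*ᴿ-cong : ∀ {x x′ y y′} → x ≃ᴿ x′ → y ≃ᴿ y′ → x *ᴿ y ≃ᴿ x′ *ᴿ y′
*ᴿ-cong {x} {x′} {y} {y′} x≃x′ y≃y′ = ≃ᴿ-trans (*ᴿ-congˡ y≃y′)
  (≃ᴿ-trans (*ᴿ-comm x y′) (≃ᴿ-trans (*ᴿ-congˡ x≃x′) (*ᴿ-comm y′ x′)))

∣p∣²≡p² : ∀ p → ∣ p ∣ ℚ.* ∣ p ∣ ≡ p ℚ.* p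
∣p∣²≡p² p with ℚₚ.∣p∣≡p∨∣p∣≡-p p
... | inj₁ eq = ≡.cong₂ ℚ._*_ eq eq
... | inj₂ eq = ≡.trans (≡.cong₂ ℚ._*_ eq eq) (solve 1 (λ a → (:- a) :* (:- a) := a :* a) ≡.refl p)

square-mono-≤ : ∀ {p q} → 0ℚ ℚ.≤ p → p ℚ.≤ q → p ℚ.* p ℚ.≤ q ℚ.* q
square-mono-≤ {p} {q} 0≤p p≤q = ℚₚ.≤-trans
  (ℚₚ.*-monoˡ-≤-nonNeg p {{ℚ.nonNegative 0≤p}} p≤q)
  (ℚₚ.*-monoʳ-≤-nonNeg q {{ℚ.nonNegative (ℚₚ.≤-trans 0≤p p≤q)}} p≤q)

0≤p² : ∀ p → 0ℚ ℚ.≤ p ℚ.* p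
0≤p² p = subst (0ℚ ℚ.≤_) (∣p∣²≡p² p) (square-mono-≤ ℚₚ.≤-refl (ℚₚ.0≤∣p∣ p))

-- Take tolerance `ε²` for `y`: an index with `∣x∣ ≥ ε` would give `ε² ≤ x² ≤ y < ε²`.
square-dominated⇒≃0 : ∀ {x y} → (∀ m → seq x m ℚ.* seq x m ℚ.≤ seq y m) → y ≃ᴿ 0ᴿ → x ≃ᴿ 0ᴿ
square-dominated⇒≃0 {x} {y} x²≤y (mk≃ᴿ y≃0) = mk≃ᴿ λ ε 0<ε →
  let N , p = y≃0 (ε ℚ.* ε) (subst (ℚ._< ε ℚ.* ε) (ℚₚ.*-zeroʳ ε)
                (ℚₚ.*-monoʳ-<-pos ε {{ℚ.positive 0<ε}} 0<ε))
  in N , λ n N≤n → ℚₚ.≰⇒> λ ε≤∣x∣ → ℚₚ.<-irrefl ≡.refl (ℚₚ.<-≤-trans (p n N≤n) (begin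
    ε ℚ.* ε                                    ≤⟨ square-mono-≤ (ℚₚ.<⇒≤ 0<ε) ε≤∣x∣ ⟩
    ∣ seq x n ℚ.- 0ℚ ∣ ℚ.* ∣ seq x n ℚ.- 0ℚ ∣  ≡⟨ ∣p∣²≡p² (seq x n ℚ.- 0ℚ) ⟩
    (seq x n ℚ.- 0ℚ) ℚ.* (seq x n ℚ.- 0ℚ)      ≡⟨ ≡.cong₂ ℚ._*_ (p-0≡p (seq x n)) (p-0≡p (seq x n)) ⟩
    seq x n ℚ.* seq x n                        ≤⟨ x²≤y n ⟩
    seq y n                                    ≡⟨ ≡.sym (ℚₚ.0≤p⇒∣p∣≡p (ℚₚ.≤-trans (0≤p² (seq x n)) (x²≤y n))) ⟩
    ∣ seq y n ∣                                ≡⟨ ≡.cong ∣_∣ (≡.sym (p-0≡p (seq y n))) ⟩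
    ∣ seq y n ℚ.- 0ℚ ∣                         ∎))
  where
  open ℚₚ.≤-Reasoning
  p-0≡p : ∀ p → p ℚ.- 0ℚ ≡ p
  p-0≡p = ℚₚ.+-identityʳ

-- Complex numbers

pointwise⇒≃ : ∀ {w z} → (∀ n → seq (re w) n ≡ seq (re z) n) →
  (∀ n → seq (im w) n ≡ seq (im z) n) → w ≃ z
pointwise⇒≃ re≗ im≗ = mk≃ (pointwise⇒≃ᴿ re≗) (pointwise⇒≃ᴿ im≗)

≃-setoid : Setoid 0ℓ 0ℓ
≃-setoid = record
  { Carrier = ℂ
  ; _≈_ = _≃_
  ; isEquivalence = record
    { refl  = mk≃ ≃ᴿ-refl ≃ᴿ-refl
    ; sym   = λ (mk≃ p q) → mk≃ (≃ᴿ-sym p) (≃ᴿ-sym q)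
    ; trans = λ (mk≃ p q) (mk≃ r s) → mk≃ (≃ᴿ-trans p r) (≃ᴿ-trans q s)
    }
  }

module _ where
  open import Algebra.Definitions _≃_
  open Consequences ≃-setoid

  +-cong′ : Congruent₂ _+_
  +-cong′ (mk≃ p q) (mk≃ r s) = mk≃ (+ᴿ-cong p r) (+ᴿ-cong q s)

  *-cong′ : Congruent₂ _*_
  *-cong′ (mk≃ p q) (mk≃ r s) = mk≃
    (+ᴿ-cong (*ᴿ-cong p r) (-ᴿ-cong (*ᴿ-cong q s)))
    (+ᴿ-cong (*ᴿ-cong p s) (*ᴿ-cong q r))

  +-assoc′ : Associative _+_
  +-assoc′ w y z = pointwise⇒≃
    (λ n → ℚₚ.+-assoc (seq (re w) n) (seq (re y) n) (seq (re z) n))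
    (λ n → ℚₚ.+-assoc (seq (im w) n) (seq (im y) n) (seq (im z) n))

  +-comm′ : Commutative _+_
  +-comm′ w z = pointwise⇒≃
    (λ n → ℚₚ.+-comm (seq (re w) n) (seq (re z) n))
    (λ n → ℚₚ.+-comm (seq (im w) n) (seq (im z) n))

  +-identityˡ′ : LeftIdentity 0ℂ _+_
  +-identityˡ′ z = pointwise⇒≃
    (λ n → ℚₚ.+-identityˡ (seq (re z) n)) (λ n → ℚₚ.+-identityˡ (seq (im z) n))

  -‿inverseˡ′ : LeftInverse 0ℂ -_ _+_
  -‿inverseˡ′ z = pointwise⇒≃
    (λ n → ℚₚ.+-inverseˡ (seq (re z) n)) (λ n → ℚₚ.+-inverseˡ (seq (im z) n))

  *-assoc′ : Associative _*_
  *-assoc′ w y z = pointwise⇒≃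
    (λ n → solve 6 (λ a b c d e f →
        (a :* c :- b :* d) :* e :- (a :* d :+ b :* c) :* f :=
        a :* (c :* e :- d :* f) :- b :* (c :* f :+ d :* e)) ≡.refl
      (seq (re w) n) (seq (im w) n) (seq (re y) n) (seq (im y) n) (seq (re z) n) (seq (im z) n))
    (λ n → solve 6 (λ a b c d e f →
        (a :* c :- b :* d) :* f :+ (a :* d :+ b :* c) :* e :=
        a :* (c :* f :+ d :* e) :+ b :* (c :* e :- d :* f)) ≡.refl
      (seq (re w) n) (seq (im w) n) (seq (re y) n) (seq (im y) n) (seq (re z) n) (seq (im z) n))

  *-comm′ : Commutative _*_
  *-comm′ w z = pointwise⇒≃
    (λ n → solve 4 (λ a b c d → a :* c :- b :* d := c :* a :- d :* b) ≡.refl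
      (seq (re w) n) (seq (im w) n) (seq (re z) n) (seq (im z) n))
    (λ n → solve 4 (λ a b c d → a :* d :+ b :* c := c :* b :+ d :* a) ≡.refl
      (seq (re w) n) (seq (im w) n) (seq (re z) n) (seq (im z) n))

  *-identityˡ′ : LeftIdentity 1ℂ _*_
  *-identityˡ′ z = pointwise⇒≃
    (λ n → solve 2 (λ a b → con 1ℚ :* a :- con 0ℚ :* b := a) ≡.refl (seq (re z) n) (seq (im z) n))
    (λ n → solve 2 (λ a b → con 1ℚ :* b :+ con 0ℚ :* a := b) ≡.refl (seq (re z) n) (seq (im z) n))

  *-distribˡ-+′ : _*_ DistributesOverˡ _+_
  *-distribˡ-+′ w y z = pointwise⇒≃
    (λ n → solve 6 (λ a b c d e f →
        a :* (c :+ e) :- b :* (d :+ f) := (a :* c :- b :* d) :+ (a :* e :- b :* f)) ≡.refl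
      (seq (re w) n) (seq (im w) n) (seq (re y) n) (seq (im y) n) (seq (re z) n) (seq (im z) n))
    (λ n → solve 6 (λ a b c d e f →
        a :* (d :+ f) :+ b :* (c :+ e) := (a :* d :+ b :* c) :+ (a :* f :+ b :* e)) ≡.refl
      (seq (re w) n) (seq (im w) n) (seq (re y) n) (seq (im y) n) (seq (re z) n) (seq (im z) n))

  -‿cong′ : Congruent₁ -_
  -‿cong′ (mk≃ p q) = mk≃ (-ᴿ-cong p) (-ᴿ-cong q)

  -- Its additive structure agrees definitionally with `+-rawMonoid`, so the general lemmas on
  -- finite sums and multiples apply to the `sum` and `×ℂ` of the matrix definitions.
  +-*-commutativeRing : CommutativeRing 0ℓ 0ℓ
  +-*-commutativeRing = record
    { Carrier = ℂ
    ; _≈_ = _≃_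
    ; _+_ = _+_
    ; _*_ = _*_
    ; -_  = -_
    ; 0#  = 0ℂ
    ; 1#  = 1ℂ
    ; isCommutativeRing = record
      { isRing = record
        { +-isAbelianGroup = record
          { isGroup = record
            { isMonoid = record
              { isSemigroup = record
                { isMagma = record
                  { isEquivalence = Setoid.isEquivalence ≃-setoid
                  ; ∙-cong = +-cong′
                  }
                ; assoc = +-assoc′
                }
              ; identity = comm∧idˡ⇒id +-comm′ +-identityˡ′
              }
            ; inverse = comm∧invˡ⇒inv +-comm′ -‿inverseˡ′
            ; ⁻¹-cong = -‿cong′
            }
          ; comm = +-comm′
          }
        ; *-cong = *-cong′
        ; *-assoc = *-assoc′
        ; *-identity = comm∧idˡ⇒id *-comm′ *-identityˡ′
        ; distrib = comm∧distrˡ⇒distr +-cong′ *-comm′ *-distribˡ-+′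
        }
      ; *-comm = *-comm′
      }
    }

open CommutativeRing +-*-commutativeRing
  hiding (Carrier; _≈_; zero; _+_; _*_; -_; 0#; 1#; ring; +-rawMonoid)
open import Relation.Binary.Reasoning.Setoid setoid
open GroupProperties +-group using (∙-cancelʳ; x≈y⇒x∙y⁻¹≈ε; x∙y⁻¹≈ε⇒x≈y; //-rightDividesˡ)
open CommutativeSemigroupProperties *-commutativeSemigroup
  using () renaming (interchange to *-interchange)
open SemiringMult semiring using (×-congʳ; ×-comm-*; ×-assoc-*)
open SemiringSum semiring
  using (sum-cong-≋; sum-replicate; sum-replicate-zero; ∑-distrib-+; ∑-comm;
         *-distribˡ-sum; *-distribʳ-sum)

-- Conjugation, the unit circle and positivity of norms

conj-cong : ∀ {w z} → w ≃ z → conj w ≃ conj z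
conj-cong (mk≃ p q) = mk≃ p (-ᴿ-cong q)

conj-involutive : ∀ z → conj (conj z) ≃ z
conj-involutive z = pointwise⇒≃ (λ _ → ≡.refl)
  (λ n → solve 1 (λ a → :- (:- a) := a) ≡.refl (seq (im z) n))

conj-+ : ∀ w z → conj (w + z) ≃ conj w + conj z
conj-+ w z = pointwise⇒≃ (λ _ → ≡.refl)
  (λ n → ℚₚ.neg-distrib-+ (seq (im w) n) (seq (im z) n))

conj-* : ∀ w z → conj (w * z) ≃ conj w * conj z
conj-* w z = pointwise⇒≃
  (λ n → solve 4 (λ a b c d → a :* c :- b :* d := a :* c :- (:- b) :* (:- d)) ≡.refl
    (seq (re w) n) (seq (im w) n) (seq (re z) n) (seq (im z) n))
  (λ n → solve 4 (λ a b c d → :- (a :* d :+ b :* c) := a :* (:- d) :+ (:- b) :* c) ≡.refl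
    (seq (re w) n) (seq (im w) n) (seq (re z) n) (seq (im z) n))

conj-0ℂ : conj 0ℂ ≃ 0ℂ
conj-0ℂ = pointwise⇒≃ (λ _ → ≡.refl) (λ _ → ≡.refl)

conj-1ℂ : conj 1ℂ ≃ 1ℂ
conj-1ℂ = pointwise⇒≃ (λ _ → ≡.refl) (λ _ → ≡.refl)

conj-sum : ∀ {n} (f : Fin n → ℂ) → conj (sum f) ≃ sum (conj ∘ f)
conj-sum {zero}  f = conj-0ℂ
conj-sum {suc n} f = trans (conj-+ (f zero) (sum (f ∘ suc))) (+-congˡ (conj-sum (f ∘ suc)))

conj-× : ∀ n z → conj (n ×ℂ z) ≃ n ×ℂ conj z
conj-× zero    z = conj-0ℂ
conj-× (suc n) z = trans (conj-+ z (n ×ℂ z)) (+-congˡ (conj-× n z))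

-- The real part of the product is the squared modulus and its imaginary part cancels. Unimodularity
-- thereby becomes a ring equation, the form in which later computations use it.
∈𝕋⇒*-conj≃1 : ∀ {z} → z ∈𝕋 → z * conj z ≃ 1ℂ
∈𝕋⇒*-conj≃1 {z} (_ , 1≃∣z∣²) = mk≃
  (≃ᴿ-trans (pointwise⇒≃ᴿ λ n →
      solve 2 (λ a b → a :* a :- b :* (:- b) := a :* a :+ b :* b) ≡.refl (seq (re z) n) (seq (im z) n))
    (≃ᴿ-trans (≃ᴿ-sym 1≃∣z∣²) (pointwise⇒≃ᴿ λ _ → ≡.refl)))
  (pointwise⇒≃ᴿ λ n →
    solve 2 (λ a b → a :* (:- b) :+ b :* a := con 0ℚ) ≡.refl (seq (re z) n) (seq (im z) n))

*-conj≃1⇒∈𝕋 : ∀ {z} → z * conj z ≃ 1ℂ → z ∈𝕋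
*-conj≃1⇒∈𝕋 {z} (mk≃ zz̄≃1 _) =
  mk≤ᴿ (λ ε 0<ε → 0 , λ _ _ → ℚₚ.+-mono-< 0<1 0<ε) ,
  ≃ᴿ-trans (pointwise⇒≃ᴿ λ _ → ≡.refl) (≃ᴿ-trans (≃ᴿ-sym zz̄≃1) (pointwise⇒≃ᴿ λ n →
    solve 2 (λ a b → a :* a :- b :* (:- b) := a :* a :+ b :* b) ≡.refl (seq (re z) n) (seq (im z) n)))

conj-∈𝕋 : ∀ {z} → z ∈𝕋 → conj z ∈𝕋
conj-∈𝕋 {z} z∈𝕋 = *-conj≃1⇒∈𝕋
  (trans (*-congˡ (conj-involutive z)) (trans (*-comm (conj z) z) (∈𝕋⇒*-conj≃1 z∈𝕋)))

*-∈𝕋 : ∀ {w z} → w ∈𝕋 → z ∈𝕋 → (w * z) ∈𝕋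
*-∈𝕋 {w} {z} w∈𝕋 z∈𝕋 = *-conj≃1⇒∈𝕋 (begin
  w * z * conj (w * z)          ≈⟨ *-congˡ (conj-* w z) ⟩
  w * z * (conj w * conj z)     ≈⟨ *-interchange w z (conj w) (conj z) ⟩
  w * conj w * (z * conj z)     ≈⟨ *-cong (∈𝕋⇒*-conj≃1 w∈𝕋) (∈𝕋⇒*-conj≃1 z∈𝕋) ⟩
  1ℂ * 1ℂ                       ≈⟨ *-identityˡ 1ℂ ⟩
  1ℂ                            ∎)

re[z*conj[z]] : ∀ z m → seq (re (z * conj z)) m ≡
  seq (re z) m ℚ.* seq (re z) m ℚ.+ seq (im z) m ℚ.* seq (im z) m
re[z*conj[z]] z m = solve 2 (λ a b → a :* a :- b :* (:- b) := a :* a :+ b :* b) ≡.refl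
  (seq (re z) m) (seq (im z) m)

0≤re[z*conj[z]] : ∀ z m → 0ℚ ℚ.≤ seq (re (z * conj z)) m
0≤re[z*conj[z]] z m = subst (0ℚ ℚ.≤_) (≡.sym (re[z*conj[z]] z m))
  (ℚₚ.+-mono-≤ (0≤p² (seq (re z) m)) (0≤p² (seq (im z) m)))

0≤re[sum] : ∀ {n} (f : Fin n → ℂ) m → 0ℚ ℚ.≤ seq (re (sum (λ k → f k * conj (f k)))) m
0≤re[sum] {zero}  f m = ℚₚ.≤-refl
0≤re[sum] {suc n} f m = ℚₚ.+-mono-≤ (0≤re[z*conj[z]] (f zero) m) (0≤re[sum] (f ∘ suc) m)

-- The discarded terms are nonnegative at every index of the sequences, so the bound holds between
-- rationals, as `square-dominated⇒≃0` demands.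
normSq≤re[sum] : ∀ {n} (f : Fin n → ℂ) k m →
  seq (re (f k)) m ℚ.* seq (re (f k)) m ℚ.+ seq (im (f k)) m ℚ.* seq (im (f k)) m ℚ.≤
  seq (re (sum (λ k → f k * conj (f k)))) m
normSq≤re[sum] f zero m = subst (ℚ._≤ seq (re (sum (λ k → f k * conj (f k)))) m)
  (≡.trans (ℚₚ.+-identityʳ _) (re[z*conj[z]] (f zero) m))
  (ℚₚ.+-monoʳ-≤ (seq (re (f zero * conj (f zero))) m) (0≤re[sum] (f ∘ suc) m))
normSq≤re[sum] f (suc k) m = ℚₚ.≤-trans (normSq≤re[sum] (f ∘ suc) k m)
  (subst (ℚ._≤ seq (re (sum (λ k → f k * conj (f k)))) m) (ℚₚ.+-identityˡ _)
    (ℚₚ.+-monoˡ-≤ _ (0≤re[z*conj[z]] (f zero) m)))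

-- Positive definiteness of the standard Hermitian form: the squares of the real and of the
-- imaginary part of `f k` are each dominated by the real part of the sum.
sum-normSq≃0⇒≃0 : ∀ {n} (f : Fin n → ℂ) → sum (λ k → f k * conj (f k)) ≃ 0ℂ → ∀ k → f k ≃ 0ℂ
sum-normSq≃0⇒≃0 f (mk≃ Σ≃0 _) k = mk≃
  (square-dominated⇒≃0 (λ m → ℚₚ.≤-trans
    (subst (ℚ._≤ x² m ℚ.+ y² m) (ℚₚ.+-identityʳ (x² m)) (ℚₚ.+-monoʳ-≤ (x² m) (0≤p² (seq (im (f k)) m))))
    (normSq≤re[sum] f k m)) Σ≃0)
  (square-dominated⇒≃0 (λ m → ℚₚ.≤-trans
    (subst (ℚ._≤ x² m ℚ.+ y² m) (ℚₚ.+-identityˡ (y² m)) (ℚₚ.+-monoˡ-≤ (y² m) (0≤p² (seq (re (f k)) m))))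
    (normSq≤re[sum] f k m)) Σ≃0)
  where
  x² y² : ℕ → ℚ
  x² m = seq (re (f k)) m ℚ.* seq (re (f k)) m
  y² m = seq (im (f k)) m ℚ.* seq (im (f k)) m

if-true : ∀ {b} {w z : ℂ} → b ≡ true → (if b then w else z) ≡ w
if-true ≡.refl = ≡.refl

if-false : ∀ {b} {w z : ℂ} → b ≡ false → (if b then w else z) ≡ z
if-false ≡.refl = ≡.refl

if-∈𝕋 : ∀ b {w z} → w ∈𝕋 → z ∈𝕋 → (if b then w else z) ∈𝕋
if-∈𝕋 true  w∈𝕋 _   = w∈𝕋
if-∈𝕋 false _   z∈𝕋 = z∈𝕋

-- Square matrices

infix 4 _≈ᴹ_

_≈ᴹ_ : ∀ {n} → Matrix n → Matrix n → Set
A ≈ᴹ B = ∀ i j → A i j ≃ B i j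

scalar : ∀ {n} → Matrix n
scalar {n} i j = n ×ℂ I i j

⊛-cong : ∀ {n} {A A′ B B′ : Matrix n} → A ≈ᴹ A′ → B ≈ᴹ B′ → A ⊛ B ≈ᴹ A′ ⊛ B′
⊛-cong A≈A′ B≈B′ i j = sum-cong-≋ λ k → *-cong (A≈A′ i k) (B≈B′ k j)

⊛-assoc : ∀ {n} (A B C : Matrix n) → (A ⊛ B) ⊛ C ≈ᴹ A ⊛ (B ⊛ C)
⊛-assoc A B C i j = begin
  sum (λ k → sum (λ l → A i l * B l k) * C k j)   ≈⟨ sum-cong-≋ (λ k → *-distribʳ-sum (C k j) (λ l → A i l * B l k)) ⟩
  sum (λ k → sum (λ l → A i l * B l k * C k j))   ≈⟨ ∑-comm (λ k l → A i l * B l k * C k j) ⟩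
  sum (λ l → sum (λ k → A i l * B l k * C k j))   ≈⟨ sum-cong-≋ (λ l → sum-cong-≋ λ k → *-assoc (A i l) (B l k) (C k j)) ⟩
  sum (λ l → sum (λ k → A i l * (B l k * C k j))) ≈⟨ sum-cong-≋ (λ l → *-distribˡ-sum (A i l) (λ k → B l k * C k j)) ⟨
  sum (λ l → A i l * sum (λ k → B l k * C k j))   ∎

I-diagonal : ∀ {n} (i : Fin n) → I i i ≡ 1ℂ
I-diagonal i = if-true (dec-true (i ≟ i) ≡.refl)

I-off-diagonal : ∀ {n} {i j : Fin n} → i ≢ j → I i j ≡ 0ℂ
I-off-diagonal {i = i} {j} i≢j = if-false (dec-false (i ≟ j) i≢j)

conj-I : ∀ {n} (i j : Fin n) → conj (I i j) ≃ I j i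
conj-I i j with i ≟ j
... | yes ≡.refl = trans conj-1ℂ (sym (reflexive (I-diagonal i)))
... | no  i≢j    = trans conj-0ℂ (sym (reflexive (I-off-diagonal (i≢j ∘ ≡.sym))))

conj-scalar : ∀ {n} (i j : Fin n) → conj (scalar i j) ≃ scalar j i
conj-scalar {n} i j = trans (conj-× n (I i j)) (×-congʳ n (conj-I i j))

sum-*-I : ∀ {n} (f : Fin n → ℂ) j → sum (λ k → f k * I k j) ≃ f j
sum-*-I {suc n} f zero = begin
  f zero * 1ℂ + sum (λ k → f (suc k) * 0ℂ) ≈⟨ +-cong (*-identityʳ _) (sum-cong-≋ λ k → zeroʳ (f (suc k))) ⟩
  f zero + sum {n} (λ _ → 0ℂ)              ≈⟨ +-congˡ (sum-replicate-zero n) ⟩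
  f zero + 0ℂ                              ≈⟨ +-identityʳ _ ⟩
  f zero                                   ∎
sum-*-I {suc n} f (suc j) = begin
  -- `I (suc k) (suc j)` computes to `I k j`, so the tail is already an instance of the induction
  -- hypothesis.
  f zero * 0ℂ + sum (λ k → f (suc k) * I k j) ≈⟨ +-cong (zeroʳ _) (sum-*-I (f ∘ suc) j) ⟩
  0ℂ + f (suc j)                              ≈⟨ +-identityˡ _ ⟩
  f (suc j)                                   ∎

-- The multiple is turned into the ring element `n ×ℂ 1ℂ`, which distributivity can then move
-- through sums.
⊛-scalar : ∀ {n} (A : Matrix n) i j → (A ⊛ scalar) i j ≃ n ×ℂ 1ℂ * A i j
⊛-scalar {n} A i j = begin
  sum (λ k → A i k * (n ×ℂ I k j))        ≈⟨ sum-cong-≋ (λ k → pull (A i k) (I k j)) ⟩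
  sum (λ k → n ×ℂ 1ℂ * (A i k * I k j))   ≈⟨ *-distribˡ-sum (n ×ℂ 1ℂ) (λ k → A i k * I k j) ⟨
  n ×ℂ 1ℂ * sum (λ k → A i k * I k j)     ≈⟨ *-congˡ (sum-*-I (A i) j) ⟩
  n ×ℂ 1ℂ * A i j                         ∎
  where
  pull : ∀ w z → w * (n ×ℂ z) ≃ n ×ℂ 1ℂ * (w * z)
  pull w z = begin
    w * (n ×ℂ z)          ≈⟨ ×-comm-* n w z ⟩
    n ×ℂ (w * z)          ≈⟨ ×-congʳ n (*-identityˡ (w * z)) ⟨
    n ×ℂ (1ℂ * (w * z))   ≈⟨ ×-assoc-* n 1ℂ (w * z) ⟨
    n ×ℂ 1ℂ * (w * z)     ∎

-- `B` is a separate argument, equivalent to `A ᴴ`, because a double conjugate is not definitionally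
-- the original entry. This lets the lemma pass from rows to columns (`A = H ᴴ`, `B = H`) as well as
-- back.
unimodular-left-inverse⇒right-inverse : ∀ {n} (A B : Matrix n) →
  B ≈ᴹ (A ᴴ) → (∀ i j → A i j * B j i ≃ 1ℂ) → B ⊛ A ≈ᴹ scalar → A ⊛ B ≈ᴹ scalar
unimodular-left-inverse⇒right-inverse {n} A B B≈Aᴴ unimodular BA≈n i j =
  x∙y⁻¹≈ε⇒x≈y (P i j) (scalar i j) (sum-normSq≃0⇒≃0 (M i) normSq≃0 j)
  where
  P M : Matrix n
  P = A ⊛ B
  M i j = P i j + - scalar i j

  P-hermitian : ∀ i j → conj (P i j) ≃ P j i
  P-hermitian i j = trans (conj-sum (λ k → A i k * B k j)) (sum-cong-≋ λ k → begin
    conj (A i k * B k j)        ≈⟨ conj-* (A i k) (B k j) ⟩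
    conj (A i k) * conj (B k j) ≈⟨ *-cong (sym (B≈Aᴴ k i)) (trans (conj-cong (B≈Aᴴ k j)) (conj-involutive (A j k))) ⟩
    B k i * A j k               ≈⟨ *-comm (B k i) (A j k) ⟩
    A j k * B k i               ∎)

  M-hermitian : ∀ i j → conj (M i j) ≃ M j i
  M-hermitian i j = trans (conj-+ (P i j) (- scalar i j)) (+-cong (P-hermitian i j)
    (-‿cong (conj-scalar i j)))

  -- Unimodularity enters here: every summand of the diagonal entry of `P` is 1.
  M-diagonal : M i i ≃ 0ℂ
  M-diagonal = x≈y⇒x∙y⁻¹≈ε (begin
    sum (λ k → A i k * B k i) ≈⟨ sum-cong-≋ (unimodular i) ⟩
    sum {n} (λ _ → 1ℂ)        ≈⟨ sum-replicate n ⟩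
    n ×ℂ 1ℂ                   ≈⟨ ×-congʳ n (reflexive (I-diagonal i)) ⟨
    n ×ℂ I i i                ∎)

  M+scalar : ∀ i j → M i j + scalar i j ≃ P i j
  M+scalar i j = //-rightDividesˡ (scalar i j) (P i j)

  -- `P² = A(BA)B`, and the inner factor `BA` is `nI`.
  PP≃nP : (P ⊛ P) i i ≃ (P ⊛ scalar) i i
  PP≃nP = begin
    (P ⊛ P) i i                 ≈⟨ ⊛-assoc P A B i i ⟨
    ((P ⊛ A) ⊛ B) i i           ≈⟨ ⊛-cong {B = B} PA≃nA (λ _ _ → refl) i i ⟩
    sum (λ k → c * A i k * B k i) ≈⟨ sum-cong-≋ (λ k → *-assoc c (A i k) (B k i)) ⟩
    sum (λ k → c * (A i k * B k i)) ≈⟨ *-distribˡ-sum c (λ k → A i k * B k i) ⟨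
    c * P i i                   ≈⟨ ⊛-scalar P i i ⟨
    (P ⊛ scalar) i i            ∎
    where
    c = n ×ℂ 1ℂ
    PA≃nA : P ⊛ A ≈ᴹ (λ i j → c * A i j)
    PA≃nA i j = begin
      (P ⊛ A) i j         ≈⟨ ⊛-assoc A B A i j ⟩
      (A ⊛ (B ⊛ A)) i j   ≈⟨ ⊛-cong {A = A} (λ _ _ → refl) BA≈n i j ⟩
      (A ⊛ scalar) i j    ≈⟨ ⊛-scalar A i j ⟩
      c * A i j           ∎

  -- `PM = P² − nP`; the term `nP` is added to both sides and cancelled.
  PM≃0 : (P ⊛ M) i i ≃ 0ℂ
  PM≃0 = ∙-cancelʳ ((P ⊛ scalar) i i) _ _ (begin
    (P ⊛ M) i i + (P ⊛ scalar) i i                  ≈⟨ ∑-distrib-+ (λ k → P i k * M k i) _ ⟨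
    sum (λ k → P i k * M k i + P i k * scalar k i)  ≈⟨ sum-cong-≋ (λ k → distribˡ (P i k) (M k i) (scalar k i)) ⟨
    sum (λ k → P i k * (M k i + scalar k i))        ≈⟨ sum-cong-≋ (λ k → *-congˡ (M+scalar k i)) ⟩
    (P ⊛ P) i i                                     ≈⟨ PP≃nP ⟩
    (P ⊛ scalar) i i                                ≈⟨ +-identityˡ _ ⟨
    0ℂ + (P ⊛ scalar) i i                           ∎)

  -- Both factors are Hermitian, so this is the conjugate of the same entry of `M ⊛ scalar`, a
  -- multiple of `M i i`.
  scalarM≃0 : (scalar ⊛ M) i i ≃ 0ℂ
  scalarM≃0 = begin
    sum (λ k → scalar i k * M k i)  ≈⟨ sum-cong-≋ (λ k → trans (*-comm _ _)
                                         (*-cong (sym (M-hermitian i k)) (sym (conj-scalar k i)))) ⟩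
    sum (λ k → conj (M i k) * conj (scalar k i)) ≈⟨ sum-cong-≋ (λ k → conj-* (M i k) (scalar k i)) ⟨
    sum (λ k → conj (M i k * scalar k i)) ≈⟨ conj-sum (λ k → M i k * scalar k i) ⟨
    conj ((M ⊛ scalar) i i)         ≈⟨ conj-cong (⊛-scalar M i i) ⟩
    conj (n ×ℂ 1ℂ * M i i)          ≈⟨ conj-cong (trans (*-congˡ M-diagonal) (zeroʳ _)) ⟩
    conj 0ℂ                         ≈⟨ conj-0ℂ ⟩
    0ℂ                              ∎

  -- Since `M` is Hermitian, the norm of its row `i` is the diagonal entry of `M²`. Adding the
  -- vanishing entry of `nM` completes `M²` to `PM`.
  normSq≃0 : sum (λ k → M i k * conj (M i k)) ≃ 0ℂ
  normSq≃0 = begin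
    sum (λ k → M i k * conj (M i k))                ≈⟨ sum-cong-≋ (λ k → *-congˡ (M-hermitian i k)) ⟩
    (M ⊛ M) i i                                     ≈⟨ +-identityʳ _ ⟨
    (M ⊛ M) i i + 0ℂ                                ≈⟨ +-congˡ scalarM≃0 ⟨
    (M ⊛ M) i i + (scalar ⊛ M) i i                  ≈⟨ ∑-distrib-+ (λ k → M i k * M k i) _ ⟨
    sum (λ k → M i k * M k i + scalar i k * M k i)  ≈⟨ sum-cong-≋ (λ k → distribʳ (M k i) (M i k) (scalar i k)) ⟨
    sum (λ k → (M i k + scalar i k) * M k i)        ≈⟨ sum-cong-≋ (λ k → *-congʳ (M+scalar i k)) ⟩
    (P ⊛ M) i i                                     ≈⟨ PM≃0 ⟩
    0ℂ                                              ∎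

-- Sums over blocks of rows

-- Has the same shape as `columnSum`, so that `columnSum H S j` is definitionally
-- `sumOn S (λ k → H k j)`.
sumOn : ∀ {n} → Subset n → (Fin n → ℂ) → ℂ
sumOn S f = sum (λ k → if does (k ∈? S) then f k else 0ℂ)

sumOn-cong : ∀ {n} (S : Subset n) {f g} → (∀ k → k ∈ S → f k ≃ g k) → sumOn S f ≃ sumOn S g
sumOn-cong S {f} {g} f≃g = sum-cong-≋ pointwise
  where
  pointwise : ∀ k → (if does (k ∈? S) then f k else 0ℂ) ≃ (if does (k ∈? S) then g k else 0ℂ)
  pointwise k with k ∈? S
  ... | yes k∈S = f≃g k k∈S
  ... | no  _   = refl

*-distribˡ-sumOn : ∀ {n} (S : Subset n) c f → c * sumOn S f ≃ sumOn S (λ k → c * f k)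
*-distribˡ-sumOn S c f = trans (*-distribˡ-sum c (λ k → if does (k ∈? S) then f k else 0ℂ)) (sum-cong-≋ pointwise)
  where
  pointwise : ∀ k → c * (if does (k ∈? S) then f k else 0ℂ) ≃ (if does (k ∈? S) then c * f k else 0ℂ)
  pointwise k with k ∈? S
  ... | yes _ = refl
  ... | no  _ = zeroʳ c

conj-sumOn : ∀ {n} (S : Subset n) f → conj (sumOn S f) ≃ sumOn S (conj ∘ f)
conj-sumOn S f = trans (conj-sum (λ k → if does (k ∈? S) then f k else 0ℂ)) (sum-cong-≋ pointwise)
  where
  pointwise : ∀ k → conj (if does (k ∈? S) then f k else 0ℂ) ≃ (if does (k ∈? S) then conj (f k) else 0ℂ)
  pointwise k with k ∈? S
  ... | yes _ = refl
  ... | no  _ = conj-0ℂ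

sum-partition : ∀ {n} {A B C : Subset n} → IsPartition A B C → ∀ f →
  sum f ≃ sumOn A f + sumOn B f + sumOn C f
sum-partition {n} {A} {B} {C} partition f = begin
  sum f                                        ≈⟨ sum-cong-≋ pointwise ⟩
  sum (λ k → part A k + part B k + part C k)   ≈⟨ ∑-distrib-+ (λ k → part A k + part B k) (part C) ⟩
  sum (λ k → part A k + part B k) + sumOn C f  ≈⟨ +-congʳ (∑-distrib-+ (part A) (part B)) ⟩
  sumOn A f + sumOn B f + sumOn C f            ∎
  where
  open IsPartition partition
  part : Subset n → Fin n → ℂ
  part S k = if does (k ∈? S) then f k else 0ℂ

  member : ∀ S {k} → k ∈ S → part S k ≃ f k
  member S {k} k∈S = reflexive (if-true (dec-true (k ∈? S) k∈S))

  nonmember : ∀ S {k} → k ∉ S → part S k ≃ 0ℂ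
  nonmember S {k} k∉S = reflexive (if-false (dec-false (k ∈? S) k∉S))

  pointwise : ∀ k → f k ≃ part A k + part B k + part C k
  pointwise k with cover k
  ... | inj₁ k∈A = sym (trans
    (+-cong (+-cong (member A k∈A) (nonmember B (A∩B≡∅ k k∈A))) (nonmember C (A∩C≡∅ k k∈A)))
    (trans (+-identityʳ _) (+-identityʳ _)))
  ... | inj₂ (inj₁ k∈B) = sym (trans
    (+-cong (+-cong (nonmember A λ k∈A → A∩B≡∅ k k∈A k∈B) (member B k∈B)) (nonmember C (B∩C≡∅ k k∈B)))
    (trans (+-identityʳ _) (+-identityˡ _)))
  ... | inj₂ (inj₂ k∈C) = sym (trans
    (+-cong (+-cong (nonmember A λ k∈A → A∩C≡∅ k k∈A k∈C) (nonmember B λ k∈B → B∩C≡∅ k k∈B k∈C)) (member C k∈C))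
    (trans (+-congʳ (+-identityʳ _)) (+-identityˡ _)))

-- The share of the rows in `S` in the inner product of columns `j` and `l`; with all rows this is
-- an entry of `(H ᴴ) ⊛ H`.
gramOn : ∀ {n} → Matrix n → Subset n → Matrix n
gramOn H S j l = sumOn S (λ k → conj (H k j) * H k l)

module _ {n} (S : Subset n) where
  -- Against an all-ones column the inner product degenerates to a column sum. This and its mirror
  -- image are how the hypotheses on entry sums enter.
  gramOn-onesʳ : ∀ {H : Matrix n} j {l} → (∀ k → k ∈ S → H k l ≃ 1ℂ) →
    gramOn H S j l ≃ conj (columnSum H S j)
  gramOn-onesʳ {H} j ones = trans
    (sumOn-cong S λ k k∈S → trans (*-congˡ (ones k k∈S)) (*-identityʳ (conj (H k j))))
    (sym (conj-sumOn S (λ k → H k j)))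

  gramOn-onesˡ : ∀ {H : Matrix n} {j} l → (∀ k → k ∈ S → H k j ≃ 1ℂ) →
    gramOn H S j l ≃ columnSum H S l
  gramOn-onesˡ {H} l ones = sumOn-cong S λ k k∈S → trans
    (*-congʳ (trans (conj-cong (ones k k∈S)) conj-1ℂ)) (*-identityˡ (H k l))

  -- The factors are constant on the block and come out of the sum; `a` is conjugated because column
  -- `j` is.
  gramOn-scale : ∀ {H K : Matrix n} {j l} a b →
    (∀ k → k ∈ S → K k j ≃ a * H k j) → (∀ k → k ∈ S → K k l ≃ b * H k l) →
    gramOn K S j l ≃ conj a * b * gramOn H S j l
  gramOn-scale {H} {K} {j} {l} a b scaleⱼ scaleₗ = trans (sumOn-cong S pointwise)
    (sym (*-distribˡ-sumOn S (conj a * b) (λ k → conj (H k j) * H k l)))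
    where
    pointwise : ∀ k → k ∈ S → conj (K k j) * K k l ≃ conj a * b * (conj (H k j) * H k l)
    pointwise k k∈S = begin
      conj (K k j) * K k l               ≈⟨ *-cong (trans (conj-cong (scaleⱼ k k∈S)) (conj-* a (H k j))) (scaleₗ k k∈S) ⟩
      conj a * conj (H k j) * (b * H k l) ≈⟨ *-interchange (conj a) (conj (H k j)) b (H k l) ⟩
      conj a * b * (conj (H k j) * H k l) ∎

-- Allows each pair of distinct column blocks to be treated in one order only.
conj-gram : ∀ {n} (H : Matrix n) j l → conj (((H ᴴ) ⊛ H) j l) ≃ ((H ᴴ) ⊛ H) l j
conj-gram H j l = trans (conj-sum (λ k → conj (H k j) * H k l)) (sum-cong-≋ λ k → begin
  conj (conj (H k j) * H k l)         ≈⟨ conj-* (conj (H k j)) (H k l) ⟩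
  conj (conj (H k j)) * conj (H k l)  ≈⟨ *-congʳ (conj-involutive (H k j)) ⟩
  H k j * conj (H k l)                ≈⟨ *-comm (H k j) (conj (H k l)) ⟩
  conj (H k l) * H k j                ∎)

-- With `H ᴴ` as first matrix and `H` as second, the left-inverse condition is exactly the
-- orthogonality of the rows of `H`.
gram-orthogonal : ∀ {n} {H : Matrix n} → IsComplexHadamard H → (H ᴴ) ⊛ H ≈ᴹ scalar
gram-orthogonal {H = H} hadamard = unimodular-left-inverse⇒right-inverse (H ᴴ) H
  (λ i j → sym (conj-involutive (H i j)))
  (λ i j → trans (*-comm (conj (H j i)) (H j i)) (∈𝕋⇒*-conj≃1 (unimodular j i)))
  orthogonal
  where open IsComplexHadamard hadamard

-- Orthogonality of the columns of the switched matrix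

module Switch
  {n} {H : Matrix n} (hadamard : IsComplexHadamard H)
  {R R₁ R₂ : Subset n} (rows : IsPartition R R₁ R₂)
  {C C₁ C₂ : Subset n} (columns : IsPartition C C₁ C₂)
  {s : ℂ}
  (R×C-sum   : EveryColumnSum H R C s)
  (R₁×C₁-sum : EveryColumnSum H R₁ C₁ (- conj s))
  (R×C₁-ones : AllOnes H R C₁)
  (R₁×C-ones : AllOnes H R₁ C)
  (R×C₂-sum  : EveryColumnSum H R C₂ 0ℂ)
  (R₁×C₂-sum : EveryColumnSum H R₁ C₂ 0ℂ)
  {z : ℂ} (z∈𝕋 : z ∈𝕋)
  where

  open IsComplexHadamard hadamard
  module Rows = IsPartition rows
  module Columns = IsPartition columns

  K : Matrix n
  K = switch z R₁ R₂ C₁ C₂ H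

  switch-∈𝕋 : ∀ i j → K i j ∈𝕋
  switch-∈𝕋 i j = if-∈𝕋 (does (i ∈? R₁) ∧ does (j ∈? C₂)) (*-∈𝕋 z∈𝕋 (unimodular i j))
    (if-∈𝕋 (does (i ∈? R₂) ∧ does (j ∈? C₁)) (*-∈𝕋 (conj-∈𝕋 z∈𝕋) (unimodular i j)) (unimodular i j))

  -- On each row block the switch multiplies column `j` by a constant that depends only on the
  -- column block of `j`. The factor on `R` is always 1, written out so that `gramOn-scale` treats
  -- all three blocks alike.
  record Scales (j : Fin n) (a b : ℂ) : Set where
    field
      on-R  : ∀ k → k ∈ R  → K k j ≃ 1ℂ * H k j
      on-R₁ : ∀ k → k ∈ R₁ → K k j ≃ a * H k j
      on-R₂ : ∀ k → k ∈ R₂ → K k j ≃ b * H k j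

  open Scales

  ∧-falseˡ : ∀ {i} (S : Subset n) {b} → i ∉ S → does (i ∈? S) ∧ b ≡ false
  ∧-falseˡ {i} S {b} i∉S = ≡.cong (_∧ b) (dec-false (i ∈? S) i∉S)

  ∧-falseʳ : ∀ {j} {b} (S : Subset n) → j ∉ S → b ∧ does (j ∈? S) ≡ false
  ∧-falseʳ {j} {b} S j∉S = ≡.trans (≡.cong (b ∧_) (dec-false (j ∈? S) j∉S)) (∧-zeroʳ b)

  ∧-true : ∀ {i j} (S T : Subset n) → i ∈ S → j ∈ T → does (i ∈? S) ∧ does (j ∈? T) ≡ true
  ∧-true {i} {j} S T i∈S j∈T = ≡.cong₂ _∧_ (dec-true (i ∈? S) i∈S) (dec-true (j ∈? T) j∈T)

  unscaled : ∀ {k j} → does (k ∈? R₁) ∧ does (j ∈? C₂) ≡ false →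
    does (k ∈? R₂) ∧ does (j ∈? C₁) ≡ false → K k j ≃ 1ℂ * H k j
  unscaled {k} {j} p q = trans (reflexive (≡.trans (if-false p) (if-false q))) (sym (*-identityˡ (H k j)))

  R-scales : ∀ j k → k ∈ R → K k j ≃ 1ℂ * H k j
  R-scales j k k∈R = unscaled (∧-falseˡ R₁ (Rows.A∩B≡∅ k k∈R)) (∧-falseˡ R₂ (Rows.A∩C≡∅ k k∈R))

  R₂⇒∉R₁ : ∀ k → k ∈ R₂ → k ∉ R₁
  R₂⇒∉R₁ k k∈R₂ k∈R₁ = Rows.B∩C≡∅ k k∈R₁ k∈R₂

  C-scales : ∀ {j} → j ∈ C → Scales j 1ℂ 1ℂ
  C-scales {j} j∈C = record
    { on-R  = R-scales j
    ; on-R₁ = λ _ _ → neither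
    ; on-R₂ = λ _ _ → neither
    }
    where
    neither : ∀ {k} → K k j ≃ 1ℂ * H k j
    neither = unscaled (∧-falseʳ C₂ (Columns.A∩C≡∅ j j∈C)) (∧-falseʳ C₁ (Columns.A∩B≡∅ j j∈C))

  C₁-scales : ∀ {j} → j ∈ C₁ → Scales j 1ℂ (conj z)
  C₁-scales {j} j∈C₁ = record
    { on-R  = R-scales j
    ; on-R₁ = λ k k∈R₁ → unscaled (∧-falseʳ C₂ (Columns.B∩C≡∅ j j∈C₁)) (∧-falseˡ R₂ (Rows.B∩C≡∅ k k∈R₁))
    -- `switch` tests for `R₁` and `C₂` first, so that test is refuted before the one for `R₂` and
    -- `C₁` can succeed.
    ; on-R₂ = λ k k∈R₂ → reflexive (≡.trans
        (if-false (∧-falseˡ R₁ (R₂⇒∉R₁ k k∈R₂))) (if-true (∧-true R₂ C₁ k∈R₂ j∈C₁)))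
    }

  C₂-scales : ∀ {j} → j ∈ C₂ → Scales j z 1ℂ
  C₂-scales {j} j∈C₂ = record
    { on-R  = R-scales j
    ; on-R₁ = λ k k∈R₁ → reflexive (if-true (∧-true R₁ C₂ k∈R₁ j∈C₂))
    ; on-R₂ = λ k k∈R₂ → unscaled (∧-falseˡ R₁ (R₂⇒∉R₁ k k∈R₂))
        (∧-falseʳ C₁ (λ j∈C₁ → Columns.B∩C≡∅ j j∈C₁ j∈C₂))
    }

  g g₁ g₂ : Matrix n
  g  = gramOn H R
  g₁ = gramOn H R₁
  g₂ = gramOn H R₂

  gram-H : ∀ j l → ((H ᴴ) ⊛ H) j l ≃ g j l + g₁ j l + g₂ j l
  gram-H j l = sum-partition rows (λ k → conj (H k j) * H k l)

  conj1*1≃1 : conj 1ℂ * 1ℂ ≃ 1ℂ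
  conj1*1≃1 = trans (*-identityʳ (conj 1ℂ)) conj-1ℂ

  -- The master formula: for each pair of column blocks it remains to compare these coefficients
  -- with those for `H`, which are all 1.
  gram-K : ∀ {j l a b a′ b′} → Scales j a b → Scales l a′ b′ →
    ((K ᴴ) ⊛ K) j l ≃ g j l + conj a * a′ * g₁ j l + conj b * b′ * g₂ j l
  gram-K {j} {l} {a} {b} {a′} {b′} σ τ = begin
    ((K ᴴ) ⊛ K) j l
      ≈⟨ sum-partition rows (λ k → conj (K k j) * K k l) ⟩
    gramOn K R j l + gramOn K R₁ j l + gramOn K R₂ j l
      ≈⟨ +-cong (+-cong unscaled-part part₁) part₂ ⟩
    g j l + conj a * a′ * g₁ j l + conj b * b′ * g₂ j l ∎
    where
    unscaled-part : gramOn K R j l ≃ g j l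
    unscaled-part = begin
      gramOn K R j l        ≈⟨ gramOn-scale R {H} {K} {j} {l} 1ℂ 1ℂ (on-R σ) (on-R τ) ⟩
      conj 1ℂ * 1ℂ * g j l  ≈⟨ *-congʳ conj1*1≃1 ⟩
      1ℂ * g j l            ≈⟨ *-identityˡ (g j l) ⟩
      g j l                 ∎
    part₁ : gramOn K R₁ j l ≃ conj a * a′ * g₁ j l
    part₁ = gramOn-scale R₁ {H} {K} {j} {l} a a′ (on-R₁ σ) (on-R₁ τ)
    part₂ : gramOn K R₂ j l ≃ conj b * b′ * g₂ j l
    part₂ = gramOn-scale R₂ {H} {K} {j} {l} b b′ (on-R₂ σ) (on-R₂ τ)

  -- Both columns carry the same unimodular factors, which cancel, so the inner product is the one
  -- in `H`. The case `j = l` is included.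
  same-block : ∀ {j l a b} → conj a * a ≃ 1ℂ → conj b * b ≃ 1ℂ → Scales j a b → Scales l a b →
    ((K ᴴ) ⊛ K) j l ≃ scalar j l
  same-block {j} {l} {a} {b} āa≃1 b̄b≃1 σ τ = begin
    ((K ᴴ) ⊛ K) j l         ≈⟨ gram-K σ τ ⟩
    g j l + conj a * a * g₁ j l + conj b * b * g₂ j l
                            ≈⟨ +-cong (+-congˡ (*-congʳ āa≃1)) (*-congʳ b̄b≃1) ⟩
    g j l + 1ℂ * g₁ j l + 1ℂ * g₂ j l
                            ≈⟨ +-cong (+-congˡ (*-identityˡ (g₁ j l))) (*-identityˡ (g₂ j l)) ⟩
    g j l + g₁ j l + g₂ j l ≈⟨ gram-H j l ⟨
    ((H ᴴ) ⊛ H) j l         ≈⟨ gram-orthogonal hadamard j l ⟩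
    scalar j l              ∎

  off-diagonal : ∀ {j l : Fin n} → j ≢ l → scalar j l ≃ 0ℂ
  off-diagonal {j} {l} j≢l = begin
    n ×ℂ I j l         ≈⟨ ×-congʳ n (reflexive (I-off-diagonal j≢l)) ⟩
    n ×ℂ 0ℂ            ≈⟨ sum-replicate n ⟨
    sum {n} (λ _ → 0ℂ) ≈⟨ sum-replicate-zero n ⟩
    0ℂ                 ∎

  gram-H≃0 : ∀ {j l} → j ≢ l → g j l + g₁ j l + g₂ j l ≃ 0ℂ
  gram-H≃0 {j} {l} j≢l = trans (sym (gram-H j l))
    (trans (gram-orthogonal hadamard j l) (off-diagonal j≢l))

  -- Column `l` is 1 on `R` and column `j` is 1 on `R₁`, so these blocks contribute `conj s` and
  -- `- conj s`. Orthogonality in `H` then forces the `R₂` share to vanish, and its factor `conj z`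
  -- does no harm.
  C-C₁-orthogonal : ∀ {j l} → j ∈ C → l ∈ C₁ → j ≢ l → ((K ᴴ) ⊛ K) j l ≃ 0ℂ
  C-C₁-orthogonal {j} {l} j∈C l∈C₁ j≢l = begin
    ((K ᴴ) ⊛ K) j l
      ≈⟨ gram-K (C-scales j∈C) (C₁-scales l∈C₁) ⟩
    g j l + conj 1ℂ * 1ℂ * g₁ j l + conj 1ℂ * conj z * g₂ j l
      ≈⟨ +-cong (+-congˡ (*-congʳ conj1*1≃1)) (*-congˡ g₂≃0) ⟩
    g j l + 1ℂ * g₁ j l + conj 1ℂ * conj z * 0ℂ
      ≈⟨ +-cong (+-congˡ (*-identityˡ (g₁ j l))) (zeroʳ (conj 1ℂ * conj z)) ⟩
    g j l + g₁ j l + 0ℂ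
      ≈⟨ +-identityʳ (g j l + g₁ j l) ⟩
    g j l + g₁ j l
      ≈⟨ g+g₁≃0 ⟩
    0ℂ ∎
    where
    g+g₁≃0 : g j l + g₁ j l ≃ 0ℂ
    g+g₁≃0 = begin
      g j l + g₁ j l                                ≈⟨ +-cong
        (gramOn-onesʳ R {H} j {l} (λ k k∈R → R×C₁-ones k l k∈R l∈C₁))
        (gramOn-onesˡ R₁ {H} {j} l (λ k k∈R₁ → R₁×C-ones k j k∈R₁ j∈C)) ⟩
      conj (columnSum H R j) + columnSum H R₁ l     ≈⟨ +-cong (conj-cong (R×C-sum j j∈C)) (R₁×C₁-sum l l∈C₁) ⟩
      conj s + - conj s                             ≈⟨ -‿inverseʳ (conj s) ⟩
      0ℂ                                            ∎

    g₂≃0 : g₂ j l ≃ 0ℂ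
    g₂≃0 = begin
      g₂ j l                    ≈⟨ +-identityˡ (g₂ j l) ⟨
      0ℂ + g₂ j l               ≈⟨ +-congʳ g+g₁≃0 ⟨
      g j l + g₁ j l + g₂ j l   ≈⟨ gram-H≃0 j≢l ⟩
      0ℂ                        ∎

  -- Only the `R₁` share acquires a factor, and it is zero: column `j` is 1 there and column `l`
  -- sums to 0.
  C-C₂-orthogonal : ∀ {j l} → j ∈ C → l ∈ C₂ → j ≢ l → ((K ᴴ) ⊛ K) j l ≃ 0ℂ
  C-C₂-orthogonal {j} {l} j∈C l∈C₂ j≢l = begin
    ((K ᴴ) ⊛ K) j l
      ≈⟨ gram-K (C-scales j∈C) (C₂-scales l∈C₂) ⟩
    g j l + conj 1ℂ * z * g₁ j l + conj 1ℂ * 1ℂ * g₂ j l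
      ≈⟨ +-cong (+-congˡ (*-congˡ g₁≃0)) (*-congʳ conj1*1≃1) ⟩
    g j l + conj 1ℂ * z * 0ℂ + 1ℂ * g₂ j l
      ≈⟨ +-cong (+-congˡ (zeroʳ (conj 1ℂ * z))) (*-identityˡ (g₂ j l)) ⟩
    g j l + 0ℂ + g₂ j l
      ≈⟨ +-congʳ (+-congˡ g₁≃0) ⟨
    g j l + g₁ j l + g₂ j l
      ≈⟨ gram-H≃0 j≢l ⟩
    0ℂ ∎
    where
    g₁≃0 : g₁ j l ≃ 0ℂ
    g₁≃0 = trans (gramOn-onesˡ R₁ {H} {j} l (λ k k∈R₁ → R₁×C-ones k j k∈R₁ j∈C)) (R₁×C₂-sum l l∈C₂)

  -- The `R` share vanishes, and the other two both acquire the factor `z`, on `R₂` as the conjugate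
  -- of `conj z`. The result is `z` times the inner product in `H`.
  C₁-C₂-orthogonal : ∀ {j l} → j ∈ C₁ → l ∈ C₂ → j ≢ l → ((K ᴴ) ⊛ K) j l ≃ 0ℂ
  C₁-C₂-orthogonal {j} {l} j∈C₁ l∈C₂ j≢l = begin
    ((K ᴴ) ⊛ K) j l
      ≈⟨ gram-K (C₁-scales j∈C₁) (C₂-scales l∈C₂) ⟩
    g j l + conj 1ℂ * z * g₁ j l + conj (conj z) * 1ℂ * g₂ j l
      ≈⟨ +-cong (+-cong g≃0 (*-congʳ (*-congʳ conj-1ℂ))) (*-congʳ (*-congʳ (conj-involutive z))) ⟩
    0ℂ + 1ℂ * z * g₁ j l + z * 1ℂ * g₂ j l
      -- The zero share of `R` is rewritten as a multiple of `z`, so that `z` can be taken out of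
      -- all three terms.
      ≈⟨ +-cong (+-cong (sym (zeroʳ z)) (*-congʳ (*-identityˡ z))) (*-congʳ (*-identityʳ z)) ⟩
    z * 0ℂ + z * g₁ j l + z * g₂ j l
      ≈⟨ +-congʳ (+-congʳ (*-congˡ g≃0)) ⟨
    z * g j l + z * g₁ j l + z * g₂ j l
      ≈⟨ +-congʳ (distribˡ z (g j l) (g₁ j l)) ⟨
    z * (g j l + g₁ j l) + z * g₂ j l
      ≈⟨ distribˡ z (g j l + g₁ j l) (g₂ j l) ⟨
    z * (g j l + g₁ j l + g₂ j l)
      ≈⟨ *-congˡ (gram-H≃0 j≢l) ⟩
    z * 0ℂ
      ≈⟨ zeroʳ z ⟩
    0ℂ ∎
    where
    g≃0 : g j l ≃ 0ℂ
    g≃0 = trans (gramOn-onesˡ R {H} {j} l (λ k k∈R → R×C₁-ones k j k∈R j∈C₁)) (R×C₂-sum l l∈C₂)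

  -- Disjointness of the blocks supplies `j ≢ l`. The second component follows from the first by
  -- Hermitian symmetry and serves the cases where the blocks occur in the opposite order.
  distinct-blocks : ∀ {j l} {A B : Subset n} → (∀ i → i ∈ A → i ∉ B) →
    (∀ {j l} → j ∈ A → l ∈ B → j ≢ l → ((K ᴴ) ⊛ K) j l ≃ 0ℂ) →
    j ∈ A → l ∈ B → ((K ᴴ) ⊛ K) j l ≃ scalar j l × ((K ᴴ) ⊛ K) l j ≃ scalar l j
  distinct-blocks {j} {l} {A} {B} A∩B≡∅ orth j∈A l∈B =
    trans gram≃0 (sym (off-diagonal j≢l)) ,
    (begin
      ((K ᴴ) ⊛ K) l j        ≈⟨ conj-gram K j l ⟨
      conj (((K ᴴ) ⊛ K) j l) ≈⟨ conj-cong gram≃0 ⟩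
      conj 0ℂ                ≈⟨ conj-0ℂ ⟩
      0ℂ                     ≈⟨ off-diagonal (j≢l ∘ ≡.sym) ⟨
      scalar l j             ∎)
    where
    j≢l : j ≢ l
    j≢l ≡.refl = A∩B≡∅ j j∈A l∈B
    gram≃0 : ((K ᴴ) ⊛ K) j l ≃ 0ℂ
    gram≃0 = orth j∈A l∈B j≢l

  columns-orthogonal : (K ᴴ) ⊛ K ≈ᴹ scalar
  columns-orthogonal j l with Columns.cover j | Columns.cover l
  ... | inj₁ j∈C         | inj₁ l∈C         = same-block conj1*1≃1 conj1*1≃1 (C-scales j∈C) (C-scales l∈C)
  ... | inj₁ j∈C         | inj₂ (inj₁ l∈C₁) = proj₁ (distinct-blocks Columns.A∩B≡∅ C-C₁-orthogonal j∈C l∈C₁)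
  ... | inj₁ j∈C         | inj₂ (inj₂ l∈C₂) = proj₁ (distinct-blocks Columns.A∩C≡∅ C-C₂-orthogonal j∈C l∈C₂)
  ... | inj₂ (inj₁ j∈C₁) | inj₁ l∈C         = proj₂ (distinct-blocks Columns.A∩B≡∅ C-C₁-orthogonal l∈C j∈C₁)
  ... | inj₂ (inj₁ j∈C₁) | inj₂ (inj₁ l∈C₁) = same-block conj1*1≃1
    (trans (*-congʳ (conj-involutive z)) (∈𝕋⇒*-conj≃1 z∈𝕋)) (C₁-scales j∈C₁) (C₁-scales l∈C₁)
  ... | inj₂ (inj₁ j∈C₁) | inj₂ (inj₂ l∈C₂) = proj₁ (distinct-blocks Columns.B∩C≡∅ C₁-C₂-orthogonal j∈C₁ l∈C₂)
  ... | inj₂ (inj₂ j∈C₂) | inj₁ l∈C         = proj₂ (distinct-blocks Columns.A∩C≡∅ C-C₂-orthogonal l∈C j∈C₂)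
  ... | inj₂ (inj₂ j∈C₂) | inj₂ (inj₁ l∈C₁) = proj₂ (distinct-blocks Columns.B∩C≡∅ C₁-C₂-orthogonal l∈C₁ j∈C₂)
  ... | inj₂ (inj₂ j∈C₂) | inj₂ (inj₂ l∈C₂) = same-block
    (trans (*-comm (conj z) z) (∈𝕋⇒*-conj≃1 z∈𝕋)) conj1*1≃1 (C₂-scales j∈C₂) (C₂-scales l∈C₂)

  switch-hadamard : IsComplexHadamard K
  switch-hadamard = record
    { unimodular = switch-∈𝕋
    -- The passage opposite to `gram-orthogonal`: from orthogonal columns of `K` back to orthogonal
    -- rows.
    ; orthogonal = unimodular-left-inverse⇒right-inverse K (K ᴴ) (λ _ _ → refl)
        (λ i j → ∈𝕋⇒*-conj≃1 (switch-∈𝕋 i j)) columns-orthogonal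
    }

theorem6p7 : (n : ℕ) (H : Matrix n) → IsComplexHadamard H →
    (R R₁ R₂ : Subset n) → IsPartition R R₁ R₂ →
    (C C₁ C₂ : Subset n) → IsPartition C C₁ C₂ →
    (s : ℂ) →
    EveryColumnSum H R C s →
    EveryColumnSum H R₁ C₁ (- conj s) →
    AllOnes H R C₁ →
    AllOnes H R₁ C →
    EveryColumnSum H R C₂ 0ℂ →
    EveryColumnSum H R₁ C₂ 0ℂ →
    (z : ℂ) → z ∈𝕋 →
    IsComplexHadamard (switch z R₁ R₂ C₁ C₂ H)
theorem6p7 n H hadamard R R₁ R₂ rows C C₁ C₂ columns s
  R×C-sum R₁×C₁-sum R×C₁-ones R₁×C-ones R×C₂-sum R₁×C₂-sum z z∈𝕋 =
  Switch.switch-hadamard hadamard rows columns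
    R×C-sum R₁×C₁-sum R×C₁-ones R₁×C-ones R×C₂-sum R₁×C₂-sum z∈𝕋
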